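{- Let $q\in\mathbb{C}$ with $0<|q|<1$ and let $a,b\in\mathbb{C}$. For every formal power series $F(z)\in\mathbb{C}[[z]]$ there is an expansion $$F(z)=\sum_{n=0}^{\infty}c_n\,z^{n}\frac{(az;q)_n}{(bz;q)_n}$$ in $\mathbb{C}[[z]]$, with coefficients $c_n$ independent of $z$ given by $$c_n=[z^{n}]\left\{F(z)\frac{(bz;q)_{n-1}}{(az;q)_{n}}\right\}-a\sum_{k=0}^{n-1}B_{n-k,1}(a,b)\,q^{(n-k)k}\,[z^{k}]\left\{F(z)\frac{(bz;q)_{k}}{(az;q)_{k+1}}\right\},$$ where the numbers $B_{n,1}(a,b)$ ($n\ge 1$) are the unique complex numbers such that $$z=\sum_{n=1}^\infty B_{n,1}(a,b)\,z^n\frac{(az;q)_n}{(bz;q)_n}\quad\text{in }\mathbb{C}[[z]].$$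
   Context: For $x\in\mathbb{C}$, $(x;q)_\infty=\prod_{i\ge 0}(1-xq^i)$ and $(x;q)_n=(x;q)_\infty/(xq^n;q)_\infty$ for every integer $n$; thus $(x;q)_0=1$, $(x;q)_n=\prod_{i=0}^{n-1}(1-xq^i)$ for $n\ge1$, and $(x;q)_{ -1}=1/(1-x/q)$. Expressions such as $(bz;q)_{n-1}/(az;q)_n$ are regarded as formal power series in $z$. For $f(z)=\sum_{n\ge0}f_nz^n\in\mathbb{C}[[z]]$, $[z^n]\{f(z)\}:=f_n$. An empty sum (e.g. $\sum_{k=0}^{ -1}$) is $0$. -}

module Defs where

open import Level using (Level; _⊔_) renaming (suc to lsuc)
open import Algebra.Bundles using (CommutativeRing)
open import Data.Nat using (ℕ; zero; suc; _∸_; _≟_) renaming (_*_ to _*ℕ_)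
open import Data.Product using (∃)
open import Relation.Nullary using (¬_; yes; no)

record Field (c ℓ : Level) : Set (lsuc (c ⊔ ℓ)) where
  field
    commutativeRing : CommutativeRing c ℓ
  open CommutativeRing commutativeRing public
  field
    0≉1     : ¬ (0# ≈ 1#)
    inverse : ∀ x → ¬ (x ≈ 0#) → ∃ λ y → x * y ≈ 1#

module FPS {c ℓ : Level} (K : Field c ℓ) (q qinv : Field.Carrier K) where
  open Field K

  Series : Set c
  Series = ℕ → Carrier

  _≈ₛ_ : Series → Series → Set ℓ
  f ≈ₛ g = ∀ m → f m ≈ g m

  coeff : ℕ → Series → Carrier
  coeff n f = f n

  sumTo : ℕ → (ℕ → Carrier) → Carrier
  sumTo zero    f = 0#
  sumTo (suc n) f = sumTo n f + f n

  pow : Carrier → ℕ → Carrier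
  pow x zero    = 1#
  pow x (suc n) = pow x n * x

  _⊛_ : Series → Series → Series
  (f ⊛ g) m = sumTo (suc m) (λ k → f k * g (m ∸ k))

  oneₛ : Series
  oneₛ zero    = 1#
  oneₛ (suc m) = 0#

  zₛ : Series
  zₛ m with m ≟ 1
  ... | yes _ = 1#
  ... | no  _ = 0#

  lin : Carrier → Series
  lin x zero          = 1#
  lin x (suc zero)    = - x
  lin x (suc (suc m)) = 0#

  geom : Carrier → Series
  geom x m = pow x m

  poch : Carrier → ℕ → Series
  poch x zero    = oneₛ
  poch x (suc n) = poch x n ⊛ lin (x * pow q n)

  pochInv : Carrier → ℕ → Series
  pochInv x zero    = oneₛ
  pochInv x (suc n) = pochInv x n ⊛ geom (x * pow q n)

  -- (xz;q)_{n-1} for n ≥ 0; for n = 0 this is (xz;q)_{-1} = 1/(1 - x z/q)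
  pochPred : Carrier → ℕ → Series
  pochPred x zero    = geom (x * qinv)
  pochPred x (suc n) = poch x n

  -- Σ_{n≥0} d n z^n (az;q)_n/(bz;q)_n in K[[z]] : its z^m coefficient is the
  -- finite sum Σ_{n=0}^{m} d n [z^{m-n}]{(az;q)_n/(bz;q)_n}
  -- (the term of index n is z^n times a series, so only n ≤ m contribute)
  expansion : (a b : Carrier) → (ℕ → Carrier) → Series
  expansion a b d m =
    sumTo (suc m) (λ n → d n * (poch a n ⊛ pochInv b n) (m ∸ n))

  -- B : ℕ → K  (only B n for n ≥ 1 is used) satisfies
  --   z = Σ_{n≥1} B n z^n (az;q)_n/(bz;q)_n
  IsB : (a b : Carrier) → (ℕ → Carrier) → Set ℓ
  IsB a b B = zₛ ≈ₛ expansion a b (λ { zero → 0# ; (suc n) → B (suc n) })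

  cCoeff : (a b : Carrier) → (ℕ → Carrier) → Series → ℕ → Carrier
  cCoeff a b B F n =
    coeff n ((F ⊛ pochPred b n) ⊛ pochInv a n)
    - (a * sumTo n (λ k →
          (B (n ∸ k) * pow q ((n ∸ k) *ℕ k))
          * coeff k ((F ⊛ poch b k) ⊛ pochInv a (suc k))))

{-# OPTIONS --safe #-}
module Submission where

-- Put φ_n = (az;q)_n/(bz;q)_n and H_n = F (bz;q)_{n-1}/(az;q)_n.  Writing drop n f = Σ_m f_{m+n} z^m,
-- the remainders R_n = φ_n (1 - bq^{n-1}z) drop n H_n satisfy R_0 = F and
-- R_n = φ_n ([z^n]H_n - aq^n z [z^n]H_{n+1}) + z R_{n+1}, so F = Σ_n z^n φ_n ([z^n]H_n - aq^n z [z^n]H_{n+1}).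
-- Replacing z by zq^k in the expansion defining B gives q^k z φ_k = Σ_i B_i q^{ik} z^i φ_{i+k};
-- substituting this into the terms linear in z and exchanging the sums yields the stated c_n.

open import Defs
open import Level using (Level)
open import Algebra.Bundles using (CommutativeSemiring)
open import Algebra.Structures using (IsCommutativeSemiring)
open import Data.Nat using (ℕ; zero; suc; _∸_; _≤_; _<_; s≤s) renaming (_+_ to _+ℕ_; _*_ to _*ℕ_)
open import Data.Nat.Properties using (+-suc; n∸n≡0; m∸n+n≡m; n<1+n; m<n⇒m<1+n; <⇒≤) renaming (+-identityʳ to +-identityʳ-ℕ)
open import Data.Product using (_×_; _,_; ∃; proj₁)
open import Function using (_∘_)
open import Relation.Nullary using (¬_)
open import Relation.Binary.Structures using (IsEquivalence)
import Algebra.Properties.Ring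
import Algebra.Solver.Ring.NaturalCoefficients.Default
import Relation.Binary.Reasoning.Setoid

module Expansion {c ℓ : Level} (K : Field c ℓ) (q qinv : Field.Carrier K) where
  open Field K
  open FPS K q qinv
  open Algebra.Properties.Ring ring using (-‿distribˡ-*; +-cancelˡ)
  open Relation.Binary.Reasoning.Setoid setoid
  private
    module KS = Algebra.Solver.Ring.NaturalCoefficients.Default commutativeSemiring

  -- Finite sums and powers in `K`.

  sumTo-cong-< : ∀ n {f g : ℕ → Carrier} → (∀ k → k < n → f k ≈ g k) → sumTo n f ≈ sumTo n g
  sumTo-cong-< zero    e = refl
  sumTo-cong-< (suc n) e = +-cong (sumTo-cong-< n (λ k k<n → e k (m<n⇒m<1+n k<n))) (e n (n<1+n n))

  sumTo-cong : ∀ n {f g : ℕ → Carrier} → (∀ k → f k ≈ g k) → sumTo n f ≈ sumTo n g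
  sumTo-cong n e = sumTo-cong-< n (λ k _ → e k)

  sumTo-+ : ∀ n (f g : ℕ → Carrier) → sumTo n (λ k → f k + g k) ≈ sumTo n f + sumTo n g
  sumTo-+ zero    f g = sym (+-identityˡ 0#)
  sumTo-+ (suc n) f g = trans (+-congʳ (sumTo-+ n f g))
    (KS.solve 4 (λ s t x y → ((s KS.:+ t) KS.:+ (x KS.:+ y)) KS.:= ((s KS.:+ x) KS.:+ (t KS.:+ y))) refl _ _ _ _)

  sumTo-*ˡ : ∀ n x (f : ℕ → Carrier) → sumTo n (λ k → x * f k) ≈ x * sumTo n f
  sumTo-*ˡ zero    x f = sym (zeroʳ x)
  sumTo-*ˡ (suc n) x f = trans (+-congʳ (sumTo-*ˡ n x f)) (sym (distribˡ x _ _))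

  sumTo-*ʳ : ∀ n x (f : ℕ → Carrier) → sumTo n (λ k → f k * x) ≈ sumTo n f * x
  sumTo-*ʳ zero    x f = sym (zeroˡ x)
  sumTo-*ʳ (suc n) x f = trans (+-congʳ (sumTo-*ʳ n x f)) (sym (distribʳ x _ _))

  sumTo-suc : ∀ n (f : ℕ → Carrier) → sumTo (suc n) f ≈ f 0 + sumTo n (f ∘ suc)
  sumTo-suc zero    f = +-comm 0# (f 0)
  sumTo-suc (suc n) f = trans (+-congʳ (sumTo-suc n f)) (+-assoc _ _ _)

  pow-+ : ∀ x m n → pow x (m +ℕ n) ≈ pow x m * pow x n
  pow-+ x zero    n = sym (*-identityˡ _)
  pow-+ x (suc m) n = trans (*-congʳ (pow-+ x m n))
    (KS.solve 3 (λ s t y → ((s KS.:* t) KS.:* y) KS.:= ((s KS.:* y) KS.:* t)) refl _ _ _)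

  pow-* : ∀ x i k → pow x (i *ℕ k) ≈ pow (pow x k) i
  pow-* x zero    k = refl
  pow-* x (suc i) k = trans (pow-+ x k (i *ℕ k)) (trans (*-comm _ _) (*-congʳ (pow-* x i k)))

  -- Formal power series as a commutative semiring.

  infixl 6 _+ₛ_
  infixr 7 _*ₗ_

  _+ₛ_ : Series → Series → Series
  (f +ₛ g) m = f m + g m

  0ₛ : Series
  0ₛ m = 0#

  _*ₗ_ : Carrier → Series → Series
  (x *ₗ f) m = x * f m

  const : Carrier → Series
  const x zero    = x
  const x (suc m) = 0#

  tail : Series → Series
  tail f m = f (suc m)

  -- Σ_{n≥0} z^n ψ_n(z); the product f ⊛ g is the special case ψ_n = f_n g.
  Σz : (ℕ → Series) → Series
  Σz ψ m = sumTo (suc m) (λ n → ψ n (m ∸ n))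

  Σz-cong : ∀ {ψ χ : ℕ → Series} → (∀ n → ψ n ≈ₛ χ n) → Σz ψ ≈ₛ Σz χ
  Σz-cong e m = sumTo-cong (suc m) (λ n → e n (m ∸ n))

  Σz-+ : ∀ (ψ χ : ℕ → Series) → Σz (λ n → ψ n +ₛ χ n) ≈ₛ (Σz ψ +ₛ Σz χ)
  Σz-+ ψ χ m = sumTo-+ (suc m) _ _

  Σz-*ₗ : ∀ x (ψ : ℕ → Series) → Σz (λ n → x *ₗ ψ n) ≈ₛ (x *ₗ Σz ψ)
  Σz-*ₗ x ψ m = sumTo-*ˡ (suc m) x _

  Σz-zero : ∀ (ψ : ℕ → Series) → Σz ψ 0 ≈ ψ 0 0
  Σz-zero ψ = +-identityˡ _

  -- As `suc m ∸ suc n` reduces to `m ∸ n`, the terms after the first are the sum of the shifted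
  -- family at order `m`. This recursion drives the inductions on coefficients below, which
  -- therefore keep `ψ` general.
  Σz-suc : ∀ (ψ : ℕ → Series) m → Σz ψ (suc m) ≈ ψ 0 (suc m) + Σz (ψ ∘ suc) m
  Σz-suc ψ m = sumTo-suc (suc m) _

  ⊛-zero : ∀ f g → (f ⊛ g) 0 ≈ f 0 * g 0
  ⊛-zero f g = Σz-zero (λ k → f k *ₗ g)

  ⊛-suc : ∀ f g m → (f ⊛ g) (suc m) ≈ f 0 * g (suc m) + (tail f ⊛ g) m
  ⊛-suc f g m = Σz-suc (λ k → f k *ₗ g) m

  ⊛-cong : ∀ {f f′ g g′} → f ≈ₛ f′ → g ≈ₛ g′ → (f ⊛ g) ≈ₛ (f′ ⊛ g′)
  ⊛-cong e e′ m = sumTo-cong (suc m) (λ k → *-cong (e k) (e′ (m ∸ k)))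

  -- Peeling the head of each factor leaves `tail f ⊛ tail g`, two orders lower, next to two terms
  -- that merely change places. The induction descends by one and by two, so order 1 is a second
  -- base case.
  ⊛-comm : ∀ f g → (f ⊛ g) ≈ₛ (g ⊛ f)
  ⊛-comm f g zero = trans (⊛-zero f g) (trans (*-comm _ _) (sym (⊛-zero g f)))
  ⊛-comm f g (suc zero) = begin
    (f ⊛ g) 1                   ≈⟨ trans (⊛-suc f g 0) (+-congˡ (⊛-zero (tail f) g)) ⟩
    f 0 * g 1 + f 1 * g 0       ≈⟨ KS.solve 4 (λ a b c d → ((a KS.:* b) KS.:+ (c KS.:* d)) KS.:= ((d KS.:* c) KS.:+ (b KS.:* a))) refl _ _ _ _ ⟩
    g 0 * f 1 + g 1 * f 0       ≈⟨ trans (⊛-suc g f 0) (+-congˡ (⊛-zero (tail g) f)) ⟨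
    (g ⊛ f) 1                   ∎
  ⊛-comm f g (suc (suc m)) = begin
    (f ⊛ g) (suc (suc m))
      ≈⟨ trans (⊛-suc f g (suc m)) (+-congˡ (⊛-comm (tail f) g (suc m))) ⟩
    f 0 * g (suc (suc m)) + (g ⊛ tail f) (suc m)
      ≈⟨ +-congˡ (⊛-suc g (tail f) m) ⟩
    f 0 * g (suc (suc m)) + (g 0 * f (suc (suc m)) + (tail g ⊛ tail f) m)
      ≈⟨ +-congˡ (+-congˡ (⊛-comm (tail g) (tail f) m)) ⟩
    f 0 * g (suc (suc m)) + (g 0 * f (suc (suc m)) + (tail f ⊛ tail g) m)
      ≈⟨ KS.solve 3 (λ a b c → (a KS.:+ (b KS.:+ c)) KS.:= (b KS.:+ (a KS.:+ c))) refl _ _ _ ⟩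
    g 0 * f (suc (suc m)) + (f 0 * g (suc (suc m)) + (tail f ⊛ tail g) m)
      ≈⟨ +-congˡ (⊛-suc f (tail g) m) ⟨
    g 0 * f (suc (suc m)) + (f ⊛ tail g) (suc m)
      ≈⟨ trans (⊛-suc g f (suc m)) (+-congˡ (⊛-comm (tail g) f (suc m))) ⟨
    (g ⊛ f) (suc (suc m)) ∎

  ⊛-distribʳ : ∀ h f g → ((f +ₛ g) ⊛ h) ≈ₛ ((f ⊛ h) +ₛ (g ⊛ h))
  ⊛-distribʳ h f g m = trans (sumTo-cong (suc m) (λ k → distribʳ _ _ _)) (sumTo-+ (suc m) _ _)

  *ₗ-⊛ : ∀ x f g → ((x *ₗ f) ⊛ g) ≈ₛ (x *ₗ (f ⊛ g))
  *ₗ-⊛ x f g m = trans (sumTo-cong (suc m) (λ k → *-assoc _ _ _)) (sumTo-*ˡ (suc m) x _)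

  -- Induction on the order: `tail (ψ 0)` and the sum of the shifted family together make up
  -- `tail (Σz ψ)`, so distributivity merges their products with `g`.
  Σz-⊛ : ∀ (ψ : ℕ → Series) g → Σz (λ n → ψ n ⊛ g) ≈ₛ (Σz ψ ⊛ g)
  Σz-⊛ ψ g zero = begin
    Σz (λ n → ψ n ⊛ g) 0 ≈⟨ trans (Σz-zero (λ n → ψ n ⊛ g)) (⊛-zero (ψ 0) g) ⟩
    ψ 0 0 * g 0          ≈⟨ *-congʳ (Σz-zero ψ) ⟨
    Σz ψ 0 * g 0         ≈⟨ ⊛-zero (Σz ψ) g ⟨
    (Σz ψ ⊛ g) 0         ∎
  Σz-⊛ ψ g (suc m) = begin
    Σz (λ n → ψ n ⊛ g) (suc m)
      ≈⟨ trans (Σz-suc (λ n → ψ n ⊛ g) m) (+-cong (⊛-suc (ψ 0) g m) (Σz-⊛ (ψ ∘ suc) g m)) ⟩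
    (ψ 0 0 * g (suc m) + (tail (ψ 0) ⊛ g) m) + (Σz (ψ ∘ suc) ⊛ g) m
      ≈⟨ trans (+-assoc _ _ _) (+-cong (*-congʳ (sym (Σz-zero ψ))) (sym (⊛-distribʳ g (tail (ψ 0)) (Σz (ψ ∘ suc)) m))) ⟩
    Σz ψ 0 * g (suc m) + ((tail (ψ 0) +ₛ Σz (ψ ∘ suc)) ⊛ g) m
      ≈⟨ +-congˡ (⊛-cong {g = g} (Σz-suc ψ) (λ _ → refl) m) ⟨
    Σz ψ 0 * g (suc m) + (tail (Σz ψ) ⊛ g) m
      ≈⟨ ⊛-suc (Σz ψ) g m ⟨
    (Σz ψ ⊛ g) (suc m) ∎

  -- `f ⊛ g` is by definition `Σz (λ k → f k *ₗ g)`, so associativity is an instance of `Σz-⊛`.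
  ⊛-assoc : ∀ f g h → ((f ⊛ g) ⊛ h) ≈ₛ (f ⊛ (g ⊛ h))
  ⊛-assoc f g h m = trans (sym (Σz-⊛ (λ k → f k *ₗ g) h m)) (Σz-cong (λ k → *ₗ-⊛ (f k) g h) m)

  0ₛ-⊛ : ∀ g → (0ₛ ⊛ g) ≈ₛ 0ₛ
  0ₛ-⊛ g m = trans (sumTo-*ˡ (suc m) 0# _) (zeroˡ _)

  constant-⊛ : ∀ f g → tail f ≈ₛ 0ₛ → (f ⊛ g) ≈ₛ (f 0 *ₗ g)
  constant-⊛ f g e zero    = ⊛-zero f g
  constant-⊛ f g e (suc m) = trans (⊛-suc f g m)
    (trans (+-congˡ (trans (⊛-cong {g = g} e (λ _ → refl) m) (0ₛ-⊛ g m))) (+-identityʳ _))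

  oneₛ-⊛ : ∀ g → (oneₛ ⊛ g) ≈ₛ g
  oneₛ-⊛ g m = trans (constant-⊛ oneₛ g (λ _ → refl) m) (*-identityˡ _)

  const-⊛ : ∀ x g → (const x ⊛ g) ≈ₛ (x *ₗ g)
  const-⊛ x g = constant-⊛ (const x) g (λ _ → refl)

  ≈ₛ-isEquivalence : IsEquivalence _≈ₛ_
  ≈ₛ-isEquivalence = record
    { refl  = λ _ → refl
    ; sym   = λ e m → sym (e m)
    ; trans = λ e e′ m → trans (e m) (e′ m)
    }

  isCommutativeSemiringₛ : IsCommutativeSemiring _≈ₛ_ _+ₛ_ _⊛_ 0ₛ oneₛ
  isCommutativeSemiringₛ = record
    { isSemiring = record
      { isSemiringWithoutAnnihilatingZero = record
        { +-isCommutativeMonoid = record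
          { isMonoid = record
            { isSemigroup = record
              { isMagma = record
                { isEquivalence = ≈ₛ-isEquivalence
                ; ∙-cong        = λ e e′ m → +-cong (e m) (e′ m)
                }
              ; assoc = λ f g h m → +-assoc _ _ _
              }
            ; identity = (λ f m → +-identityˡ _) , (λ f m → +-identityʳ _)
            }
          ; comm = λ f g m → +-comm _ _
          }
        ; *-cong     = ⊛-cong
        ; *-assoc    = ⊛-assoc
        ; *-identity = oneₛ-⊛ , (λ f m → trans (⊛-comm f oneₛ m) (oneₛ-⊛ f m))
        ; distrib    = (λ h f g m → trans (⊛-comm h (f +ₛ g) m)
                         (trans (⊛-distribʳ h f g m) (+-cong (⊛-comm f h m) (⊛-comm g h m))))
                     , ⊛-distribʳ
        }
      ; zero = 0ₛ-⊛ , (λ f m → trans (⊛-comm f 0ₛ m) (0ₛ-⊛ f m))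
      }
    ; *-comm = ⊛-comm
    }

  -- Gives access to the ring solver for series. Signs sit inside scalars such as `const (- x)`,
  -- which it treats as atoms, so a semiring suffices.
  seriesSemiring : CommutativeSemiring c ℓ
  seriesSemiring = record { isCommutativeSemiring = isCommutativeSemiringₛ }

  private
    module S = CommutativeSemiring seriesSemiring
    module SR = Relation.Binary.Reasoning.Setoid S.setoid
    module SS = Algebra.Solver.Ring.NaturalCoefficients.Default seriesSemiring

  -- Constants, multiplication by z, and linear factors with their inverses.

  const-+ : ∀ x y → const (x + y) ≈ₛ (const x +ₛ const y)
  const-+ x y zero    = refl
  const-+ x y (suc m) = sym (+-identityˡ 0#)

  const-* : ∀ x y → const (x * y) ≈ₛ (const x ⊛ const y)
  const-* x y m = trans (lemma m) (sym (const-⊛ x (const y) m))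
    where
    lemma : const (x * y) ≈ₛ (x *ₗ const y)
    lemma zero    = refl
    lemma (suc m) = sym (zeroʳ x)

  const-cong : ∀ {x y} → x ≈ y → const x ≈ₛ const y
  const-cong e zero    = e
  const-cong e (suc m) = refl

  z-⊛-zero : ∀ f → (zₛ ⊛ f) 0 ≈ 0#
  z-⊛-zero f = trans (⊛-zero zₛ f) (zeroˡ _)

  z-⊛-suc : ∀ f m → (zₛ ⊛ f) (suc m) ≈ f m
  z-⊛-suc f m = begin
    (zₛ ⊛ f) (suc m)                   ≈⟨ ⊛-suc zₛ f m ⟩
    0# * f (suc m) + (tail zₛ ⊛ f) m   ≈⟨ +-cong (zeroˡ _) (constant-⊛ (tail zₛ) f (λ _ → refl) m) ⟩
    0# + 1# * f m                      ≈⟨ trans (+-identityˡ _) (*-identityˡ _) ⟩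
    f m                                ∎

  head-tail : ∀ f → f ≈ₛ (const (f 0) +ₛ (zₛ ⊛ tail f))
  head-tail f zero    = sym (trans (+-congˡ (z-⊛-zero (tail f))) (+-identityʳ _))
  head-tail f (suc m) = sym (trans (+-congˡ (z-⊛-suc (tail f) m)) (+-identityˡ _))

  lin-tail : ∀ x → tail (lin x) ≈ₛ const (- x)
  lin-tail x zero    = refl
  lin-tail x (suc m) = refl

  lin-expand : ∀ x → lin x ≈ₛ (oneₛ +ₛ (const (- x) ⊛ zₛ))
  lin-expand x = S.trans (head-tail (lin x)) (S.+-cong
    (λ { zero → refl ; (suc m) → refl })
    (S.trans (S.*-congˡ {zₛ} (lin-tail x)) (⊛-comm zₛ (const (- x)))))

  lin-⊛ : ∀ x f → (lin x ⊛ f) ≈ₛ (f +ₛ (- x *ₗ (zₛ ⊛ f)))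
  lin-⊛ x f = SR.begin
    lin x ⊛ f                              SR.≈⟨ S.*-congʳ {f} (lin-expand x) ⟩
    (oneₛ +ₛ (const (- x) ⊛ zₛ)) ⊛ f       SR.≈⟨ SS.solve 3 (λ k z g → ((SS.con 1 SS.:+ (k SS.:* z)) SS.:* g) SS.:= (g SS.:+ (k SS.:* (z SS.:* g)))) (λ {_} → S.refl) (const (- x)) zₛ f ⟩
    f +ₛ (const (- x) ⊛ (zₛ ⊛ f))          SR.≈⟨ S.+-congˡ {f} (const-⊛ (- x) (zₛ ⊛ f)) ⟩
    f +ₛ (- x *ₗ (zₛ ⊛ f))                 SR.∎

  -- Past order 0 each coefficient is x^(m+1) - x x^m. Every later cancellation of a linear factor
  -- against its inverse rests on this.
  lin-geom : ∀ x → (lin x ⊛ geom x) ≈ₛ oneₛ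
  lin-geom x zero    = trans (lin-⊛ x (geom x) 0) (trans (+-congˡ (trans (*-congˡ (z-⊛-zero (geom x))) (zeroʳ _))) (+-identityʳ _))
  lin-geom x (suc m) = begin
    (lin x ⊛ geom x) (suc m)              ≈⟨ lin-⊛ x (geom x) (suc m) ⟩
    pow x m * x + - x * (zₛ ⊛ geom x) (suc m)
      ≈⟨ +-cong (*-comm _ _) (trans (*-congˡ (z-⊛-suc (geom x) m)) (sym (-‿distribˡ-* x _))) ⟩
    x * pow x m + - (x * pow x m)         ≈⟨ -‿inverseʳ _ ⟩
    0#                                    ∎

  -- Expansions Σ z^n ψ_n: recurrences, interchange of sums, uniqueness, existence.

  -- Each use of the recurrence puts one more factor z before the remainder, so the coefficient of
  -- order `m` is settled after `m + 1` uses. The induction passes to the shifted sequences.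
  Σz-unfold : ∀ (R ψ : ℕ → Series) → (∀ n → R n ≈ₛ (ψ n +ₛ (zₛ ⊛ R (suc n)))) → R 0 ≈ₛ Σz ψ
  Σz-unfold R ψ e zero    = trans (e 0 0) (trans (+-congˡ (z-⊛-zero (R 1))) (trans (+-identityʳ _) (sym (Σz-zero ψ))))
  Σz-unfold R ψ e (suc m) = begin
    R 0 (suc m)                          ≈⟨ e 0 (suc m) ⟩
    ψ 0 (suc m) + (zₛ ⊛ R 1) (suc m)     ≈⟨ +-congˡ (trans (z-⊛-suc (R 1) m) (Σz-unfold (R ∘ suc) (ψ ∘ suc) (e ∘ suc) m)) ⟩
    ψ 0 (suc m) + Σz (ψ ∘ suc) m         ≈⟨ Σz-suc ψ m ⟨
    Σz ψ (suc m)                         ∎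

  sumₛ : ℕ → (ℕ → Series) → Series
  sumₛ n f m = sumTo n (λ k → f k m)

  -- Both sides sum z^(k+i) `θ k i`, the left one grouped by n = k + i. The induction splits off k =
  -- 0 and shifts `θ` in its first argument.
  Σz-exchange : ∀ (θ : ℕ → ℕ → Series) →
    Σz (λ n → sumₛ (suc n) (λ k → θ k (n ∸ k))) ≈ₛ Σz (λ k → Σz (θ k))
  Σz-exchange θ zero    = refl
  Σz-exchange θ (suc m) = begin
    Σz (λ n → sumₛ (suc n) (λ k → θ k (n ∸ k))) (suc m)
      ≈⟨ Σz-cong (λ n j → sumTo-suc n (λ k → θ k (n ∸ k) j)) (suc m) ⟩
    Σz (λ n → θ 0 n +ₛ G n) (suc m)
      -- `G 0` is an empty sum and `G (suc n)` is the antidiagonal sum of `θ ∘ suc` at `n`, so the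
      -- order drops by one.
      ≈⟨ trans (Σz-+ (θ 0) G (suc m)) (+-congˡ (trans (Σz-suc G m) (+-identityˡ _))) ⟩
    Σz (θ 0) (suc m) + Σz (G ∘ suc) m
      ≈⟨ +-congˡ (Σz-exchange (θ ∘ suc) m) ⟩
    Σz (θ 0) (suc m) + Σz (λ k → Σz (θ (suc k))) m
      ≈⟨ Σz-suc (λ k → Σz (θ k)) m ⟨
    Σz (λ k → Σz (θ k)) (suc m) ∎
    where
    G : ℕ → Series
    G n = sumₛ n (λ k → θ (suc k) (n ∸ suc k))

  -- The system for the coefficients is triangular with unit diagonal: order 0 gives `d 0 ≈ d′ 0`,
  -- and cancelling that term and dividing by z leaves the same problem for the shifted families.
  Σz-injective : ∀ n (ψ : ℕ → Series) (d d′ : ℕ → Carrier) → (∀ i → ψ i 0 ≈ 1#) →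
    Σz (λ i → d i *ₗ ψ i) ≈ₛ Σz (λ i → d′ i *ₗ ψ i) → d n ≈ d′ n
  Σz-injective n ψ d d′ monic e = go n
    where
    head≈ : d 0 ≈ d′ 0
    head≈ = begin
      d 0                         ≈⟨ trans (*-congˡ (monic 0)) (*-identityʳ _) ⟨
      d 0 * ψ 0 0                 ≈⟨ Σz-zero (λ i → d i *ₗ ψ i) ⟨
      Σz (λ i → d i *ₗ ψ i) 0     ≈⟨ e 0 ⟩
      Σz (λ i → d′ i *ₗ ψ i) 0    ≈⟨ Σz-zero (λ i → d′ i *ₗ ψ i) ⟩
      d′ 0 * ψ 0 0                ≈⟨ trans (*-congˡ (monic 0)) (*-identityʳ _) ⟩
      d′ 0                        ∎
    tail≈ : Σz (λ i → d (suc i) *ₗ ψ (suc i)) ≈ₛ Σz (λ i → d′ (suc i) *ₗ ψ (suc i))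
    tail≈ m = +-cancelˡ (d 0 * ψ 0 (suc m)) _ _ (begin
      d 0 * ψ 0 (suc m) + Σz (λ i → d (suc i) *ₗ ψ (suc i)) m   ≈⟨ Σz-suc (λ i → d i *ₗ ψ i) m ⟨
      Σz (λ i → d i *ₗ ψ i) (suc m)                             ≈⟨ e (suc m) ⟩
      Σz (λ i → d′ i *ₗ ψ i) (suc m)                            ≈⟨ Σz-suc (λ i → d′ i *ₗ ψ i) m ⟩
      d′ 0 * ψ 0 (suc m) + Σz (λ i → d′ (suc i) *ₗ ψ (suc i)) m ≈⟨ +-congʳ (*-congʳ head≈) ⟨
      d 0 * ψ 0 (suc m) + Σz (λ i → d′ (suc i) *ₗ ψ (suc i)) m  ∎)
    go : ∀ k → d k ≈ d′ k
    go zero    = head≈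
    go (suc k) = Σz-injective k (ψ ∘ suc) (d ∘ suc) (d′ ∘ suc) (monic ∘ suc) tail≈

  -- When every `ψ i` has constant term 1, this is `F` minus the first `n` terms of its expansion,
  -- divided by z^n; its constant term is then the next coefficient.
  remainder : Series → (ℕ → Series) → ℕ → Series
  remainder F ψ zero    = F
  remainder F ψ (suc n) m = remainder F ψ n (suc m) - remainder F ψ n 0 * ψ n (suc m)

  -- Subtracting from a remainder its constant term times `ψ n` removes order 0, so division by z is
  -- exact; `Σz-unfold` assembles these divisions.
  Σz-surjective : ∀ F (ψ : ℕ → Series) → (∀ i → ψ i 0 ≈ 1#) →
    F ≈ₛ Σz (λ n → remainder F ψ n 0 *ₗ ψ n)
  Σz-surjective F ψ monic = Σz-unfold (remainder F ψ) _ step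
    where
    step : ∀ n → remainder F ψ n ≈ₛ ((remainder F ψ n 0 *ₗ ψ n) +ₛ (zₛ ⊛ remainder F ψ (suc n)))
    step n zero    = sym (trans (+-cong (trans (*-congˡ (monic n)) (*-identityʳ _)) (z-⊛-zero (remainder F ψ (suc n)))) (+-identityʳ _))
    step n (suc m) = begin
      x                      ≈⟨ +-identityˡ x ⟨
      0# + x                 ≈⟨ +-congʳ (-‿inverseʳ y) ⟨
      (y + - y) + x          ≈⟨ trans (+-assoc _ _ _) (+-congˡ (+-comm _ _)) ⟩
      y + (x + - y)          ≈⟨ +-congˡ (z-⊛-suc (remainder F ψ (suc n)) m) ⟨
      y + (zₛ ⊛ remainder F ψ (suc n)) (suc m) ∎
      where
      x = remainder F ψ n (suc m)
      y = remainder F ψ n 0 * ψ n (suc m)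

  -- The substitution of sz for z, realised by `scale`, and its effect on products.

  scale : Carrier → Series → Series
  scale s f m = pow s m * f m

  scale-Σz : ∀ s (ψ : ℕ → Series) → scale s (Σz ψ) ≈ₛ Σz (λ n → pow s n *ₗ scale s (ψ n))
  scale-Σz s ψ zero    = KS.solve 1 (λ x → (KS.con 1 KS.:* (KS.con 0 KS.:+ x)) KS.:= (KS.con 0 KS.:+ (KS.con 1 KS.:* (KS.con 1 KS.:* x)))) refl (ψ 0 0)
  scale-Σz s ψ (suc m) = begin
    (pow s m * s) * Σz ψ (suc m)
      ≈⟨ *-congˡ (Σz-suc ψ m) ⟩
    (pow s m * s) * (ψ 0 (suc m) + Σz (ψ ∘ suc) m)
      ≈⟨ KS.solve 4 (λ p t x y → ((p KS.:* t) KS.:* (x KS.:+ y)) KS.:= ((KS.con 1 KS.:* ((p KS.:* t) KS.:* x)) KS.:+ (t KS.:* (p KS.:* y)))) refl _ _ _ _ ⟩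
    1# * scale s (ψ 0) (suc m) + s * scale s (Σz (ψ ∘ suc)) m
      ≈⟨ +-congˡ (*-congˡ (scale-Σz s (ψ ∘ suc) m)) ⟩
    1# * scale s (ψ 0) (suc m) + s * Σz (λ n → pow s n *ₗ scale s (ψ (suc n))) m
      ≈⟨ +-congˡ (sym (Σz-*ₗ s (λ n → pow s n *ₗ scale s (ψ (suc n))) m)) ⟩
    1# * scale s (ψ 0) (suc m) + Σz (λ n → s *ₗ pow s n *ₗ scale s (ψ (suc n))) m
      ≈⟨ +-congˡ (Σz-cong (λ n j → trans (sym (*-assoc s (pow s n) _)) (*-congʳ {scale s (ψ (suc n)) j} (*-comm s (pow s n)))) m) ⟩
    1# * scale s (ψ 0) (suc m) + Σz (λ n → pow s (suc n) *ₗ scale s (ψ (suc n))) m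
      ≈⟨ Σz-suc (λ n → pow s n *ₗ scale s (ψ n)) m ⟨
    Σz (λ n → pow s n *ₗ scale s (ψ n)) (suc m) ∎

  -- The case `ψ k = f k *ₗ g` of `scale-Σz`: the factor s^k joins `f k` to form a coefficient of
  -- `scale s f`.
  scale-⊛ : ∀ s f g → scale s (f ⊛ g) ≈ₛ (scale s f ⊛ scale s g)
  scale-⊛ s f g m = trans (scale-Σz s (λ k → f k *ₗ g) m)
    (Σz-cong (λ n j → KS.solve 4 (λ p t x y → (p KS.:* (t KS.:* (x KS.:* y))) KS.:= ((p KS.:* x) KS.:* (t KS.:* y))) refl (pow s n) (pow s j) (f n) (g j)) m)

  scale-cong : ∀ s {f g} → f ≈ₛ g → scale s f ≈ₛ scale s g
  scale-cong s e m = *-congˡ (e m)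

  scale-oneₛ : ∀ s → scale s oneₛ ≈ₛ oneₛ
  scale-oneₛ s zero    = *-identityˡ _
  scale-oneₛ s (suc m) = zeroʳ _

  scale-zₛ : ∀ s → scale s zₛ ≈ₛ (s *ₗ zₛ)
  scale-zₛ s zero          = trans (zeroʳ _) (sym (zeroʳ _))
  scale-zₛ s (suc zero)    = *-congʳ (*-identityˡ s)
  scale-zₛ s (suc (suc m)) = trans (zeroʳ _) (sym (zeroʳ _))

  lin-cong : ∀ {x y} → x ≈ y → lin x ≈ₛ lin y
  lin-cong e zero          = refl
  lin-cong e (suc zero)    = -‿cong e
  lin-cong e (suc (suc m)) = refl

  scale-lin : ∀ s x → scale s (lin x) ≈ₛ lin (x * s)
  scale-lin s x zero          = *-identityˡ _
  scale-lin s x (suc zero)    = trans (*-congʳ (*-identityˡ s)) (trans (*-comm _ _) (sym (-‿distribˡ-* x s)))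
  scale-lin s x (suc (suc m)) = zeroʳ _

  geom-cong : ∀ {x y} → x ≈ y → geom x ≈ₛ geom y
  geom-cong e zero    = refl
  geom-cong e (suc m) = *-cong (geom-cong e m) e

  scale-geom : ∀ s x → scale s (geom x) ≈ₛ geom (x * s)
  scale-geom s x zero    = *-identityˡ _
  scale-geom s x (suc m) = trans
    (KS.solve 4 (λ p t u y → ((p KS.:* t) KS.:* (u KS.:* y)) KS.:= ((p KS.:* u) KS.:* (y KS.:* t))) refl _ _ _ _)
    (*-congʳ (scale-geom s x m))

  -- For L = lin this reads (xz;q)_{i+k} = (xz;q)_k (xq^k z;q)_i.
  product-+ : ∀ (L : Carrier → Series) (P : ℕ → Series) x →
    (∀ {y y′} → y ≈ y′ → L y ≈ₛ L y′) → (∀ s y → scale s (L y) ≈ₛ L (y * s)) →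
    P 0 ≈ₛ oneₛ → (∀ n → P (suc n) ≈ₛ (P n ⊛ L (x * pow q n))) →
    ∀ i k → P (i +ℕ k) ≈ₛ (P k ⊛ scale (pow q k) (P i))
  product-+ L P x L-cong scale-L P-zero P-suc zero k = S.sym (SR.begin
    P k ⊛ scale (pow q k) (P 0)
      SR.≈⟨ S.*-congˡ {P k} (S.trans (scale-cong (pow q k) P-zero) (scale-oneₛ (pow q k))) ⟩
    P k ⊛ oneₛ SR.≈⟨ S.*-identityʳ (P k) ⟩
    P k        SR.∎)
  product-+ L P x L-cong scale-L P-zero P-suc (suc i) k = SR.begin
    P (suc i +ℕ k)
      SR.≈⟨ P-suc (i +ℕ k) ⟩
    P (i +ℕ k) ⊛ L (x * pow q (i +ℕ k))
      -- Substituting q^k z for z turns the factor with parameter x q^i into the one with parameter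
      -- x q^(i+k).
      SR.≈⟨ S.*-cong (product-+ L P x L-cong scale-L P-zero P-suc i k)
              (S.trans (L-cong (trans (*-congˡ (pow-+ q i k)) (sym (*-assoc _ _ _))))
                       (S.sym (scale-L s (x * pow q i)))) ⟩
    (P k ⊛ scale s (P i)) ⊛ scale s (L (x * pow q i))
      SR.≈⟨ ⊛-assoc (P k) (scale s (P i)) (scale s (L (x * pow q i))) ⟩
    P k ⊛ (scale s (P i) ⊛ scale s (L (x * pow q i)))
      SR.≈⟨ S.*-congˡ {P k} (S.trans (scale-cong s (P-suc i)) (scale-⊛ s (P i) (L (x * pow q i)))) ⟨
    P k ⊛ scale s (P (suc i)) SR.∎
    where
    s = pow q k

  -- Constant terms of the shifted factorials, and one telescoping step.

  poch-zero : ∀ x n → poch x n 0 ≈ 1#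
  poch-zero x zero    = refl
  poch-zero x (suc n) = trans (⊛-zero (poch x n) (lin (x * pow q n))) (trans (*-identityʳ _) (poch-zero x n))

  pochInv-zero : ∀ x n → pochInv x n 0 ≈ 1#
  pochInv-zero x zero    = refl
  pochInv-zero x (suc n) = trans (⊛-zero (pochInv x n) (geom (x * pow q n))) (trans (*-identityʳ _) (pochInv-zero x n))

  -- The index is `m +ℕ n` so that a successor in `m` computes and `z-⊛-suc` applies at once; the
  -- price is a rewrite for `drop (suc n)` and `drop 0`.
  drop : ℕ → Series → Series
  drop n f m = f (m +ℕ n)

  -- With U = F (bz)_{n-1}/(az)_{n+1}, α = aq^n and β = bq^{n-1} this is one step of the telescoping.
  drop-lin-lin : ∀ n α β U →
    (lin β ⊛ drop n (lin α ⊛ U)) ≈ₛ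
      ((const ((lin α ⊛ U) n) +ₛ (const (- α * (lin β ⊛ U) n) ⊛ zₛ))
        +ₛ (zₛ ⊛ (lin α ⊛ drop (suc n) (lin β ⊛ U))))
  drop-lin-lin n α β U = SR.begin
    lin β ⊛ drop n (lin α ⊛ U)
      SR.≈⟨ S.*-cong (lin-expand β) (S.trans drop-lin (S.+-cong V≈ (S.*-congˡ {A} (S.+-congˡ {T} (S.*-congˡ {zₛ} V≈))))) ⟩
    (oneₛ +ₛ (B ⊛ zₛ)) ⊛ ((u +ₛ (zₛ ⊛ W)) +ₛ (A ⊛ (T +ₛ (zₛ ⊛ (u +ₛ (zₛ ⊛ W))))))
      -- Both sides are now polynomials in z, the scalars -α and -β, and three pieces of `U`: its
      -- coefficients of order n - 1 (`T`) and n (`u`), and the part above, `W`.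
      SR.≈⟨ SS.solve 6 (λ z A B u t w →
              ((SS.con 1 SS.:+ (B SS.:* z)) SS.:* ((u SS.:+ (z SS.:* w)) SS.:+ (A SS.:* (t SS.:+ (z SS.:* (u SS.:+ (z SS.:* w)))))))
              SS.:=
              (((u SS.:+ (A SS.:* t)) SS.:+ ((A SS.:* (u SS.:+ (B SS.:* t))) SS.:* z))
                SS.:+ (z SS.:* ((SS.con 1 SS.:+ (A SS.:* z)) SS.:* (w SS.:+ (B SS.:* (u SS.:+ (z SS.:* w))))))))
              (λ {_} → S.refl) zₛ A B u T W ⟩
    ((u +ₛ (A ⊛ T)) +ₛ ((A ⊛ (u +ₛ (B ⊛ T))) ⊛ zₛ))
      +ₛ (zₛ ⊛ ((oneₛ +ₛ (A ⊛ zₛ)) ⊛ (W +ₛ (B ⊛ (u +ₛ (zₛ ⊛ W))))))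
      SR.≈⟨ S.+-cong
              (S.+-cong (coefficient α) (S.*-congʳ {zₛ} (S.trans (const-* (- α) _) (S.*-congˡ {A} (coefficient β)))))
              (S.*-congˡ {zₛ} (S.*-cong (lin-expand α) (S.trans drop-suc-lin (S.+-congˡ {W} (S.*-congˡ {B} V≈))))) ⟨
    (const ((lin α ⊛ U) n) +ₛ (const (- α * (lin β ⊛ U) n) ⊛ zₛ))
      +ₛ (zₛ ⊛ (lin α ⊛ drop (suc n) (lin β ⊛ U))) SR.∎
    where
    A = const (- α)
    B = const (- β)
    V = drop n U
    u = const (U n)
    W = tail V
    -- The coefficient of order n - 1 of `U`, or 0 when n = 0; multiplying by `zₛ` avoids a case
    -- split.
    T = const ((zₛ ⊛ U) n)
    V≈ : V ≈ₛ (u +ₛ (zₛ ⊛ W))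
    V≈ = head-tail V
    coefficient : ∀ x → const ((lin x ⊛ U) n) ≈ₛ (u +ₛ (const (- x) ⊛ T))
    coefficient x = S.trans (const-cong (lin-⊛ x U n))
      (S.trans (const-+ (U n) _) (S.+-congˡ {u} (const-* (- x) ((zₛ ⊛ U) n))))
    drop-z : drop n (zₛ ⊛ U) ≈ₛ (T +ₛ (zₛ ⊛ V))
    drop-z = S.trans (head-tail (drop n (zₛ ⊛ U)))
      (S.+-congˡ {T} (S.*-congˡ {zₛ} (λ m → z-⊛-suc U (m +ℕ n))))
    drop-lin : drop n (lin α ⊛ U) ≈ₛ (V +ₛ (A ⊛ (T +ₛ (zₛ ⊛ V))))
    drop-lin = S.trans (λ m → lin-⊛ α U (m +ℕ n))
      (S.+-congˡ {V} (S.trans (S.sym (const-⊛ (- α) (drop n (zₛ ⊛ U)))) (S.*-congˡ {A} drop-z)))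
    drop-suc-lin : drop (suc n) (lin β ⊛ U) ≈ₛ (W +ₛ (B ⊛ V))
    drop-suc-lin m rewrite +-suc m n = trans (lin-⊛ β U (suc (m +ℕ n)))
      (+-congˡ (trans (*-congˡ (z-⊛-suc U (m +ℕ n))) (sym (const-⊛ (- β) V m))))

  -- The quotients (az;q)_n/(bz;q)_n and the numbers B_{n,1}.

  module Expand (a b : Carrier) where

    φ : ℕ → Series
    φ n = poch a n ⊛ pochInv b n

    φ-monic : ∀ n → φ n 0 ≈ 1#
    φ-monic n = trans (⊛-zero (poch a n) (pochInv b n))
      (trans (*-cong (poch-zero a n) (pochInv-zero b n)) (*-identityˡ 1#))

    -- `product-+` splits the numerator with `L = lin` and the denominator with `L = geom`; `scale`
    -- is multiplicative, so the shifted pieces recombine.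
    φ-+ : ∀ i k → φ (i +ℕ k) ≈ₛ (φ k ⊛ scale (pow q k) (φ i))
    φ-+ i k = SR.begin
      poch a (i +ℕ k) ⊛ pochInv b (i +ℕ k)
        SR.≈⟨ S.*-cong (product-+ lin (poch a) a lin-cong scale-lin S.refl (λ _ → S.refl) i k)
                       (product-+ geom (pochInv b) b geom-cong scale-geom S.refl (λ _ → S.refl) i k) ⟩
      (poch a k ⊛ scale s (poch a i)) ⊛ (pochInv b k ⊛ scale s (pochInv b i))
        SR.≈⟨ SS.solve 4 (λ t u v w → ((t SS.:* u) SS.:* (v SS.:* w)) SS.:= ((t SS.:* v) SS.:* (u SS.:* w))) (λ {_} → S.refl)
                (poch a k) (scale s (poch a i)) (pochInv b k) (scale s (pochInv b i)) ⟩
      φ k ⊛ (scale s (poch a i) ⊛ scale s (pochInv b i))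
        SR.≈⟨ S.*-congˡ {φ k} (scale-⊛ s (poch a i) (pochInv b i)) ⟨
      φ k ⊛ scale s (φ i) SR.∎
      where
      s = pow q k

    -- Named form of the anonymous function in `IsB`, so that later statements can mention it; the
    -- value 0 at index 0 turns a sum over n ≥ 1 into a `Σz`.
    withZero : (ℕ → Carrier) → ℕ → Carrier
    withZero B zero    = 0#
    withZero B (suc n) = B (suc n)

    IsB⇒ : ∀ B → IsB a b B → zₛ ≈ₛ Σz (λ n → withZero B n *ₗ φ n)
    IsB⇒ B h = S.trans h (λ m → sumTo-cong (suc m) (λ { zero → refl ; (suc n) → refl }))

    B-exists : ∃ λ B → IsB a b B
    -- At index 0 the computed coefficient is the constant term of z, which reduces to the 0
    -- prescribed by `IsB`.
    B-exists = B , S.trans (Σz-surjective zₛ φ φ-monic) (λ m → sumTo-cong (suc m) (λ { zero → refl ; (suc n) → refl }))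
      where
      B : ℕ → Carrier
      B n = remainder zₛ φ n 0

    B-unique : ∀ B B′ → IsB a b B → IsB a b B′ → ∀ n → 1 ≤ n → B n ≈ B′ n
    B-unique B B′ h h′ (suc n) _ = Σz-injective (suc n) φ (withZero B) (withZero B′) φ-monic
      (S.trans (S.sym (IsB⇒ B h)) (IsB⇒ B′ h′))

    -- q^k z · φ_k, expanded by substituting zq^k for z in the expansion of z.
    shifted-z : ∀ B → IsB a b B → ∀ k →
      Σz (λ i → (withZero B i * pow (pow q k) i) *ₗ φ (i +ℕ k)) ≈ₛ (φ k ⊛ (pow q k *ₗ zₛ))
    shifted-z B h k = SR.begin
      Σz (λ i → (withZero B i * pow s i) *ₗ φ (i +ℕ k))
        -- By `φ-+` every term contains the factor `φ k`, which then leaves the sum; what remains is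
        -- the expansion of z at q^k z.
        SR.≈⟨ Σz-cong term ⟩
      Σz (λ i → (pow s i *ₗ scale s (withZero B i *ₗ φ i)) ⊛ φ k)
        SR.≈⟨ Σz-⊛ (λ i → pow s i *ₗ scale s (withZero B i *ₗ φ i)) (φ k) ⟩
      Σz (λ i → pow s i *ₗ scale s (withZero B i *ₗ φ i)) ⊛ φ k
        SR.≈⟨ S.*-congʳ {φ k} (scale-Σz s (λ i → withZero B i *ₗ φ i)) ⟨
      scale s (Σz (λ i → withZero B i *ₗ φ i)) ⊛ φ k
        SR.≈⟨ S.*-congʳ {φ k} (S.trans (scale-cong s (S.sym (IsB⇒ B h))) (scale-zₛ s)) ⟩
      (s *ₗ zₛ) ⊛ φ k
        SR.≈⟨ ⊛-comm (s *ₗ zₛ) (φ k) ⟩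
      φ k ⊛ (s *ₗ zₛ) SR.∎
      where
      s = pow q k
      term : ∀ i → ((withZero B i * pow s i) *ₗ φ (i +ℕ k)) ≈ₛ ((pow s i *ₗ scale s (withZero B i *ₗ φ i)) ⊛ φ k)
      term i = SR.begin
        (withZero B i * pow s i) *ₗ φ (i +ℕ k)
          SR.≈⟨ (λ m → *-congˡ (trans (φ-+ i k m) (⊛-comm (φ k) (scale s (φ i)) m))) ⟩
        (withZero B i * pow s i) *ₗ (scale s (φ i) ⊛ φ k)
          SR.≈⟨ *ₗ-⊛ (withZero B i * pow s i) (scale s (φ i)) (φ k) ⟨
        ((withZero B i * pow s i) *ₗ scale s (φ i)) ⊛ φ k
          SR.≈⟨ S.*-congʳ {φ k} (λ m → KS.solve 4 (λ x t u y → ((x KS.:* t) KS.:* (u KS.:* y)) KS.:= (t KS.:* (u KS.:* (x KS.:* y)))) refl (withZero B i) (pow s i) (pow s m) (φ i m)) ⟩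
        (pow s i *ₗ scale s (withZero B i *ₗ φ i)) ⊛ φ k SR.∎

    β : ℕ → Carrier
    β zero    = b * qinv
    β (suc n) = b * pow q n

    pochPred-step : ∀ n → (pochPred b n ⊛ lin (β n)) ≈ₛ poch b n
    pochPred-step zero    = S.trans (⊛-comm (geom (b * qinv)) (lin (b * qinv))) (lin-geom (b * qinv))
    pochPred-step (suc n) = S.refl

    -- The ratio of `φ (suc n)` to `φ n` is (1 - aq^n z)/(1 - bq^n z), and the denominator cancels
    -- against `lin (β (suc n))`. This passes from one remainder to the next.
    φ-suc-⊛ : ∀ n X → (φ (suc n) ⊛ (lin (β (suc n)) ⊛ X)) ≈ₛ (φ n ⊛ (lin (a * pow q n) ⊛ X))
    φ-suc-⊛ n X = SR.begin
      ((poch a n ⊛ lin α) ⊛ (pochInv b n ⊛ geom β′)) ⊛ (lin β′ ⊛ X)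
        SR.≈⟨ SS.solve 6 (λ p A r g L x → (((p SS.:* A) SS.:* (r SS.:* g)) SS.:* (L SS.:* x)) SS.:= ((L SS.:* g) SS.:* ((p SS.:* r) SS.:* (A SS.:* x)))) (λ {_} → S.refl)
                (poch a n) (lin α) (pochInv b n) (geom β′) (lin β′) X ⟩
      (lin β′ ⊛ geom β′) ⊛ (φ n ⊛ (lin α ⊛ X))
        SR.≈⟨ S.*-congʳ {φ n ⊛ (lin α ⊛ X)} (lin-geom β′) ⟩
      oneₛ ⊛ (φ n ⊛ (lin α ⊛ X))
        SR.≈⟨ oneₛ-⊛ (φ n ⊛ (lin α ⊛ X)) ⟩
      φ n ⊛ (lin α ⊛ X) SR.∎
      where
      α = a * pow q n
      β′ = b * pow q n

    -- The expansion of an arbitrary series.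

    module _ (F : Series) where

      -- One family serves both extractions in `cCoeff`: `pochPred b (suc k)` reduces to `poch b k`,
      -- so the series under the sum is `H (suc k)`.
      H : ℕ → Series
      H n = (F ⊛ pochPred b n) ⊛ pochInv a n

      linear-expansion :
        F ≈ₛ Σz (λ n → φ n ⊛ (const (H n n) +ₛ (const (- (a * pow q n) * H (suc n) n) ⊛ zₛ)))
      linear-expansion = S.trans initial (Σz-unfold R _ step)
        where
        -- Without `drop n` this product would equal `F` for every n; `R n` keeps the part of `H n`
        -- from order n on, divided by z^n.
        R : ℕ → Series
        R n = φ n ⊛ (lin (β n) ⊛ drop n (H n))
        initial : F ≈ₛ R 0
        initial = S.sym (SR.begin
          (oneₛ ⊛ oneₛ) ⊛ (lin (b * qinv) ⊛ drop 0 (H 0))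
            SR.≈⟨ S.*-congˡ {oneₛ ⊛ oneₛ} (S.*-congˡ {lin (b * qinv)} drop-zero) ⟩
          (oneₛ ⊛ oneₛ) ⊛ (lin (b * qinv) ⊛ ((F ⊛ geom (b * qinv)) ⊛ oneₛ))
            SR.≈⟨ SS.solve 3 (λ L g f → ((SS.con 1 SS.:* SS.con 1) SS.:* (L SS.:* ((f SS.:* g) SS.:* SS.con 1))) SS.:= ((L SS.:* g) SS.:* f)) (λ {_} → S.refl)
                    (lin (b * qinv)) (geom (b * qinv)) F ⟩
          (lin (b * qinv) ⊛ geom (b * qinv)) ⊛ F
            SR.≈⟨ S.trans (S.*-congʳ {F} (lin-geom (b * qinv))) (oneₛ-⊛ F) ⟩
          F SR.∎)
          where
          drop-zero : drop 0 (H 0) ≈ₛ H 0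
          drop-zero m rewrite +-identityʳ-ℕ m = refl
        step : ∀ n → R n ≈ₛ
          ((φ n ⊛ (const (H n n) +ₛ (const (- (a * pow q n) * H (suc n) n) ⊛ zₛ))) +ₛ (zₛ ⊛ R (suc n)))
        step n = SR.begin
          φ n ⊛ (lin (β n) ⊛ drop n (H n))
            SR.≈⟨ S.*-congˡ {φ n} (S.*-congˡ {lin (β n)} (λ m → lin-α (m +ℕ n))) ⟨
          φ n ⊛ (lin (β n) ⊛ drop n (lin α ⊛ U))
            SR.≈⟨ S.*-congˡ {φ n} (drop-lin-lin n α (β n) U) ⟩
          φ n ⊛ ((const ((lin α ⊛ U) n) +ₛ (const (- α * (lin (β n) ⊛ U) n) ⊛ zₛ))
                  +ₛ (zₛ ⊛ (lin α ⊛ drop (suc n) (lin (β n) ⊛ U))))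
            SR.≈⟨ S.*-congˡ {φ n} (S.+-cong
                    (S.+-cong (const-cong (lin-α n)) (S.*-congʳ {zₛ} (const-cong (*-congˡ (lin-β n)))))
                    (S.*-congˡ {zₛ} (S.*-congˡ {lin α} (λ m → lin-β (m +ℕ suc n))))) ⟩
          φ n ⊛ (E +ₛ (zₛ ⊛ (lin α ⊛ X)))
            SR.≈⟨ SS.solve 4 (λ p e z y → (p SS.:* (e SS.:+ (z SS.:* y))) SS.:= ((p SS.:* e) SS.:+ (z SS.:* (p SS.:* y)))) (λ {_} → S.refl)
                    (φ n) E zₛ (lin α ⊛ X) ⟩
          (φ n ⊛ E) +ₛ (zₛ ⊛ (φ n ⊛ (lin α ⊛ X)))
            SR.≈⟨ S.+-congˡ {φ n ⊛ E} (S.*-congˡ {zₛ} (φ-suc-⊛ n X)) ⟨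
          (φ n ⊛ E) +ₛ (zₛ ⊛ R (suc n)) SR.∎
          where
          α = a * pow q n
          -- The common part of two consecutive `H`: `lin α` cancels the last factor of
          -- `pochInv a (suc n)`, giving `H n`, and `lin (β n)` completes `pochPred b n`, giving
          -- `H (suc n)`.
          U = (F ⊛ pochPred b n) ⊛ pochInv a (suc n)
          E = const (H n n) +ₛ (const (- α * H (suc n) n) ⊛ zₛ)
          X = drop (suc n) (H (suc n))
          lin-α : (lin α ⊛ U) ≈ₛ H n
          lin-α = SR.begin
            lin α ⊛ ((F ⊛ pochPred b n) ⊛ (pochInv a n ⊛ geom α))
              SR.≈⟨ SS.solve 4 (λ A y i g → (A SS.:* (y SS.:* (i SS.:* g))) SS.:= ((A SS.:* g) SS.:* (y SS.:* i))) (λ {_} → S.refl)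
                      (lin α) (F ⊛ pochPred b n) (pochInv a n) (geom α) ⟩
            (lin α ⊛ geom α) ⊛ H n
              SR.≈⟨ S.trans (S.*-congʳ {H n} (lin-geom α)) (oneₛ-⊛ (H n)) ⟩
            H n SR.∎
          lin-β : (lin (β n) ⊛ U) ≈ₛ H (suc n)
          lin-β = SR.begin
            lin (β n) ⊛ ((F ⊛ pochPred b n) ⊛ pochInv a (suc n))
              SR.≈⟨ SS.solve 4 (λ L f p i → (L SS.:* ((f SS.:* p) SS.:* i)) SS.:= ((f SS.:* (p SS.:* L)) SS.:* i)) (λ {_} → S.refl)
                      (lin (β n)) F (pochPred b n) (pochInv a (suc n)) ⟩
            (F ⊛ (pochPred b n ⊛ lin (β n))) ⊛ pochInv a (suc n)
              SR.≈⟨ S.*-congʳ {pochInv a (suc n)} (S.*-congˡ {F} (pochPred-step n)) ⟩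
            H (suc n) SR.∎

      expansion-cCoeff : ∀ B → IsB a b B → F ≈ₛ expansion a b (cCoeff a b B F)
      expansion-cCoeff B h = S.sym (SR.begin
        Σz (λ n → cCoeff a b B F n *ₗ φ n)
          SR.≈⟨ Σz-cong coefficient ⟩
        Σz (λ n → (H n n *ₗ φ n) +ₛ sumₛ (suc n) (λ k → θ k (n ∸ k)))
          SR.≈⟨ Σz-+ (λ n → H n n *ₗ φ n) (λ n → sumₛ (suc n) (λ k → θ k (n ∸ k))) ⟩
        Σz (λ n → H n n *ₗ φ n) +ₛ Σz (λ n → sumₛ (suc n) (λ k → θ k (n ∸ k)))
          -- Once regrouped by k, the inner sum over i = n - k is `shifted-z` at k times `g k`.
          SR.≈⟨ S.+-congˡ {Σz (λ n → H n n *ₗ φ n)} (S.trans (Σz-exchange θ) (Σz-cong Σz-θ)) ⟩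
        Σz (λ n → H n n *ₗ φ n) +ₛ Σz (λ n → g n *ₗ (φ n ⊛ (pow q n *ₗ zₛ)))
          SR.≈⟨ Σz-+ (λ n → H n n *ₗ φ n) (λ n → g n *ₗ (φ n ⊛ (pow q n *ₗ zₛ))) ⟨
        Σz (λ n → (H n n *ₗ φ n) +ₛ (g n *ₗ (φ n ⊛ (pow q n *ₗ zₛ))))
          SR.≈⟨ Σz-cong linear-term ⟩
        Σz (λ n → φ n ⊛ (const (H n n) +ₛ (const (- (a * pow q n) * H (suc n) n) ⊛ zₛ)))
          SR.≈⟨ linear-expansion ⟨
        F SR.∎)
        where
        g : ℕ → Carrier
        g k = - a * H (suc k) k
        -- The share of index k + i in the expansion of the linear term at index k.
        θ : ℕ → ℕ → Series
        θ k i = g k *ₗ (withZero B i * pow (pow q k) i) *ₗ φ (i +ℕ k)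

        Σz-θ : ∀ k → Σz (θ k) ≈ₛ (g k *ₗ (φ k ⊛ (pow q k *ₗ zₛ)))
        Σz-θ k m = trans (Σz-*ₗ (g k) (λ i → (withZero B i * pow (pow q k) i) *ₗ φ (i +ℕ k)) m)
          (*-congˡ (shifted-z B h k m))

        linear-term : ∀ n → ((H n n *ₗ φ n) +ₛ (g n *ₗ (φ n ⊛ (pow q n *ₗ zₛ)))) ≈ₛ
          (φ n ⊛ (const (H n n) +ₛ (const (- (a * pow q n) * H (suc n) n) ⊛ zₛ)))
        linear-term n = SR.begin
          (H n n *ₗ φ n) +ₛ (g n *ₗ (φ n ⊛ (Q *ₗ zₛ)))
            SR.≈⟨ S.+-cong (const-⊛ (H n n) (φ n))
                    (S.trans (const-⊛ (g n) (φ n ⊛ (const Q ⊛ zₛ))) (λ m → *-congˡ (S.*-congˡ {φ n} (const-⊛ Q zₛ) m))) ⟨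
          (const (H n n) ⊛ φ n) +ₛ (const (g n) ⊛ (φ n ⊛ (const Q ⊛ zₛ)))
            SR.≈⟨ SS.solve 5 (λ e d p Q z → ((e SS.:* p) SS.:+ (d SS.:* (p SS.:* (Q SS.:* z)))) SS.:= (p SS.:* (e SS.:+ ((d SS.:* Q) SS.:* z)))) (λ {_} → S.refl)
                    (const (H n n)) (const (g n)) (φ n) (const Q) zₛ ⟩
          φ n ⊛ (const (H n n) +ₛ ((const (g n) ⊛ const Q) ⊛ zₛ))
            SR.≈⟨ S.*-congˡ {φ n} (S.+-congˡ {const (H n n)} (S.*-congʳ {zₛ} (S.trans (S.sym (const-* (g n) Q)) (const-cong scalar)))) ⟩
          φ n ⊛ (const (H n n) +ₛ (const (- (a * Q) * H (suc n) n) ⊛ zₛ)) SR.∎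
          where
          Q = pow q n
          scalar : g n * Q ≈ - (a * Q) * H (suc n) n
          scalar = trans
            (KS.solve 3 (λ x y z → ((x KS.:* y) KS.:* z) KS.:= ((x KS.:* z) KS.:* y)) refl (- a) (H (suc n) n) Q)
            (*-congʳ (sym (-‿distribˡ-* a Q)))

        coefficient : ∀ n → (cCoeff a b B F n *ₗ φ n) ≈ₛ ((H n n *ₗ φ n) +ₛ sumₛ (suc n) (λ k → θ k (n ∸ k)))
        coefficient n m = begin
          (H n n - a * sumTo n t) * φ n m
            ≈⟨ distribʳ _ _ _ ⟩
          H n n * φ n m + - (a * sumTo n t) * φ n m
            ≈⟨ +-congˡ (*-congʳ (trans (-‿distribˡ-* a _) (sym (sumTo-*ˡ n (- a) t)))) ⟩
          H n n * φ n m + sumTo n (λ k → - a * t k) * φ n m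
            ≈⟨ +-congˡ (sym (sumTo-*ʳ n (φ n m) (λ k → - a * t k))) ⟩
          H n n * φ n m + sumTo n (λ k → (- a * t k) * φ n m)
            ≈⟨ +-congˡ (sumTo-cong-< n term) ⟩
          H n n * φ n m + sumTo n (λ k → θ k (n ∸ k) m)
            -- The added index k = n, which completes the antidiagonal for `Σz-exchange`,
            -- contributes nothing because it carries `withZero B 0`.
            ≈⟨ +-congˡ (trans (+-congˡ last) (+-identityʳ _)) ⟨
          H n n * φ n m + sumTo (suc n) (λ k → θ k (n ∸ k) m) ∎
          where
          t : ℕ → Carrier
          t k = (B (n ∸ k) * pow q ((n ∸ k) *ℕ k)) * H (suc k) k
          last : θ n (n ∸ n) m ≈ 0#
          last rewrite n∸n≡0 n = trans (*-congˡ (trans (*-congʳ (zeroˡ _)) (zeroˡ _))) (zeroʳ _)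
          withZero-∸ : ∀ n k → k < n → B (n ∸ k) ≈ withZero B (n ∸ k)
          withZero-∸ (suc n) zero    _         = refl
          withZero-∸ (suc n) (suc k) (s≤s k<n) = withZero-∸ n k k<n
          term : ∀ k → k < n → (- a * t k) * φ n m ≈ θ k (n ∸ k) m
          -- The bound k < n makes `(n ∸ k) +ℕ k` equal to `n`, and makes `n ∸ k` positive, where
          -- `withZero B` agrees with `B`.
          term k k<n rewrite m∸n+n≡m (<⇒≤ k<n) = begin
            (- a * ((B (n ∸ k) * pow q ((n ∸ k) *ℕ k)) * H (suc k) k)) * φ n m
              ≈⟨ *-congʳ (*-congˡ (*-congʳ (*-cong (withZero-∸ n k k<n) (pow-* q (n ∸ k) k)))) ⟩
            (- a * ((withZero B (n ∸ k) * pow (pow q k) (n ∸ k)) * H (suc k) k)) * φ n m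
              ≈⟨ KS.solve 4 (λ x y z w → ((x KS.:* (y KS.:* z)) KS.:* w) KS.:= ((x KS.:* z) KS.:* (y KS.:* w))) refl (- a) _ (H (suc k) k) (φ n m) ⟩
            g k * ((withZero B (n ∸ k) * pow (pow q k) (n ∸ k)) * φ n m) ∎

theorem1p1 : ∀ {c ℓ : Level} (K : Field c ℓ) → let open Field K in
    (q : Carrier) (q≉0 : ¬ (q ≈ 0#)) (a b : Carrier) →
    let open FPS K q (proj₁ (inverse q q≉0)) in
    (∃ λ B → IsB a b B)
    × (∀ B B′ → IsB a b B → IsB a b B′ → ∀ n → 1 ≤ n → B n ≈ B′ n)
    × (∀ B → IsB a b B → ∀ (F : Series) →
    F ≈ₛ expansion a b (cCoeff a b B F))
theorem1p1 K q q≉0 a b = B-exists , B-unique , (λ B h F → expansion-cCoeff F B h)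
  where
  open Expansion K q (proj₁ (Field.inverse K q q≉0))
  open Expand a b
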